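{- The (safe, depth-unbounded) blossom-based dynamic matching algorithm described in the context maintains a maximum cardinality matching under edge insertions and edge deletions: if the matching held by the algorithm is a maximum cardinality matching of the current graph before an update (insertion or deletion of one edge), then the matching held after processing the update is a maximum cardinality matching of the updated graph.
   Context: Graphs are finite, undirected, without parallel edges and self-loops, on a fixed vertex set; each update inserts or deletes one edge. A matching $\mathcal{M}$ is a set of edges no two of which share a vertex. A vertex is free if it is not incident to an edge of $\mathcal{M}$ and matched otherwise. An alternating path is a cycle-free path whose edges alternate between $\mathcal{M}$ and its complement; an augmenting path is an alternating path that starts and ends at (distinct) free vertices, with edges of $\mathcal{M}$ alternating with edges not in $\mathcal{M}$. An "augmenting path search" from a free vertex $x$ is a procedure (e.g. Edmonds' blossom search) that finds an augmenting path starting at $x$ if one exists in the current graph with respect to the current matching, and in that case augments along it (matched edges of the path become unmatched and vice versa, increasing the matching size by one); otherwise it changes nothing. Edge insertion of $\{u,v\}$. (1) If $u$ and $v$ are both free, $\{u,v\}$ is added to the matching. (2) Otherwise, if one of $u,v$ is free, an augmenting path search is started from that free endpoint. (3) If $u$ and $v$ are both matched, a breadth first search from $u$ is performed to find a free vertex reachable from $u$ via an alternating path; if such a vertex is found, an augmenting path search is started from that single vertex (otherwise nothing is done). Edge deletion of $\{u,v\}$. The edge is removed from the graph (and from the matching if it was matched). Then an augmenting path search is started from each endpoint $u$, $v$ that is free (for the second endpoint, only if it is still free after the first search). "Safe" means that case (3) of the insertion is executed; "depth-unbounded" means that the augmenting path searches are not limited in length. -}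

module Defs where

open import Algebra.Properties.CommutativeMonoid.Sum using (sum)
open import Data.Bool.Base using (Bool; true; false; not; _∧_; _∨_; _xor_; if_then_else_)
open import Data.Bool.Properties using (∧-comm; ∨-comm)
import Data.Bool.Properties as Bool
open import Data.Fin.Base using (Fin)
open import Data.Fin.Properties using (_≟_; _≤?_; any?)
open import Data.List.Base using (List; []; _∷_; head; last)
open import Data.List.Relation.Unary.Linked using (Linked)
open import Data.List.Relation.Unary.Unique.Propositional using (Unique)
open import Data.Maybe.Base using (Maybe; just; nothing)
open import Data.Nat.Base using (ℕ; _≤_)
open import Data.Nat.Properties using (+-0-commutativeMonoid)
open import Data.Product.Base using (∃; ∃₂; _×_)
open import Relation.Binary.PropositionalEquality
  using (_≡_; _≢_; refl; sym; trans; cong; cong₂)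
open import Relation.Nullary using (¬_; Dec; yes; no; does; ¬?; contradiction)

private variable
  n : ℕ

-- A set of unordered pairs of vertices.  Loops are excluded by `Graph`, and hence
-- also from the matchings of a graph.
record EdgeSet (n : ℕ) : Set where
  field
    mem           : Fin n → Fin n → Bool
    mem-symmetric : ∀ x y → mem x y ≡ mem y x

open EdgeSet public

infix 4 _—_∈_
infixl 6 _∪_ _∖_ _△_

_—_∈_ : Fin n → Fin n → EdgeSet n → Set
x — y ∈ S = mem S x y ≡ true

∅ : EdgeSet n
∅ .mem _ _ = false
∅ .mem-symmetric _ _ = refl

｛_—_｝ : Fin n → Fin n → EdgeSet n
｛ u — v ｝ .mem x y =
  (does (x ≟ u) ∧ does (y ≟ v)) ∨ (does (x ≟ v) ∧ does (y ≟ u))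
｛ u — v ｝ .mem-symmetric x y =
  trans (∨-comm (does (x ≟ u) ∧ does (y ≟ v)) _)
        (cong₂ _∨_ (∧-comm (does (x ≟ v)) _) (∧-comm (does (x ≟ u)) _))

_∪_ _∖_ _△_ : EdgeSet n → EdgeSet n → EdgeSet n
(S ∪ T) .mem x y = mem S x y ∨ mem T x y
(S ∪ T) .mem-symmetric x y = cong₂ _∨_ (mem-symmetric S x y) (mem-symmetric T x y)
(S ∖ T) .mem x y = mem S x y ∧ not (mem T x y)
(S ∖ T) .mem-symmetric x y =
  cong₂ (λ a b → a ∧ not b) (mem-symmetric S x y) (mem-symmetric T x y)
(S △ T) .mem x y = mem S x y xor mem T x y
(S △ T) .mem-symmetric x y = cong₂ _xor_ (mem-symmetric S x y) (mem-symmetric T x y)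

-- The restriction to i ≤ j counts each unordered pair once.
∣_∣ : EdgeSet n → ℕ
∣_∣ {n} S = ∑ λ (i : Fin n) → ∑ λ (j : Fin n) →
            if does (i ≤? j) ∧ mem S i j then 1 else 0
  where ∑ = sum +-0-commutativeMonoid

record Graph (n : ℕ) : Set where
  field
    edges    : EdgeSet n
    loopless : ∀ x → mem edges x x ≡ false

open Graph public

record IsMatching (G : Graph n) (M : EdgeSet n) : Set where
  field
    subset   : ∀ {x y} → x — y ∈ M → x — y ∈ edges G
    disjoint : ∀ {x y z} → x — y ∈ M → x — z ∈ M → y ≡ z

record IsMaximumMatching (G : Graph n) (M : EdgeSet n) : Set where
  field
    isMatching : IsMatching G M
    maximum    : ∀ N → IsMatching G N → ∣ N ∣ ≤ ∣ M ∣

Free : EdgeSet n → Fin n → Set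
Free M x = ¬ ∃ λ y → x — y ∈ M

free? : (M : EdgeSet n) (x : Fin n) → Dec (Free M x)
free? M x = ¬? (any? λ y → mem M x y Bool.≟ true)

-- Of any two consecutive edges of the vertex list, exactly one lies in M.
data Alternates (M : EdgeSet n) : List (Fin n) → Set where
  []   : Alternates M []
  [_]  : ∀ x → Alternates M (x ∷ [])
  [_,_] : ∀ x y → Alternates M (x ∷ y ∷ [])
  _∷_  : ∀ {x y z p} → mem M x y ≡ not (mem M y z) →
         Alternates M (y ∷ z ∷ p) → Alternates M (x ∷ y ∷ z ∷ p)

record AlternatingPath (G : Graph n) (M : EdgeSet n)
                       (x y : Fin n) (p : List (Fin n)) : Set where
  field
    starts     : head p ≡ just x
    ends       : last p ≡ just y
    walk       : Linked (_—_∈ edges G) p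
    cycle-free : Unique p
    alternates : Alternates M p

record AugmentingPath (G : Graph n) (M : EdgeSet n)
                      (x y : Fin n) (p : List (Fin n)) : Set where
  field
    alternatingPath : AlternatingPath G M x y p
    distinct        : x ≢ y
    start-free      : Free M x
    end-free        : Free M y

pathEdges : List (Fin n) → EdgeSet n
pathEdges []          = ∅
pathEdges (x ∷ [])    = ∅
pathEdges (x ∷ y ∷ p) = ｛ x — y ｝ ∪ pathEdges (y ∷ p)

AugmentingPathResult : Graph n → EdgeSet n → Fin n → Maybe (List (Fin n)) → Set
AugmentingPathResult G M x (just p) = ∃ λ y → AugmentingPath G M x y p
AugmentingPathResult G M x nothing  = ¬ ∃₂ λ y p → AugmentingPath G M x y p

ReachableFree : Graph n → EdgeSet n → Fin n → Fin n → Set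
ReachableFree G M u x = Free M x × ∃ λ p → AlternatingPath G M u x p

ReachableFreeResult : Graph n → EdgeSet n → Fin n → Maybe (Fin n) → Set
ReachableFreeResult G M u (just x) = ReachableFree G M u x
ReachableFreeResult G M u nothing  = ¬ ∃ λ x → ReachableFree G M u x

-- The two search procedures are unspecified except for what they find; path
-- lengths are not bounded.
record Procedures (n : ℕ) : Set where
  field
    findAugmentingPath : Graph n → EdgeSet n → Fin n → Maybe (List (Fin n))
    findAugmentingPath-correct :
      ∀ {G M} x → IsMatching G M → Free M x →
      AugmentingPathResult G M x (findAugmentingPath G M x)

    findReachableFree : Graph n → EdgeSet n → Fin n → Maybe (Fin n)
    findReachableFree-correct :
      ∀ {G M} u → IsMatching G M → ¬ Free M u →
      ReachableFreeResult G M u (findReachableFree G M u)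

data Update (G : Graph n) : Set where
  insert : ∀ u v → u ≢ v → ¬ (u — v ∈ edges G) → Update G
  delete : ∀ u v → u — v ∈ edges G → Update G

insertEdge : (G : Graph n) (u v : Fin n) → u ≢ v → Graph n
insertEdge G u v u≢v .edges = edges G ∪ ｛ u — v ｝
insertEdge G u v u≢v .loopless x rewrite loopless G x with x ≟ u | x ≟ v
... | yes refl | yes refl = contradiction refl u≢v
... | yes _    | no  _    = refl
... | no  _    | yes _    = refl
... | no  _    | no  _    = refl

deleteEdge : Graph n → Fin n → Fin n → Graph n
deleteEdge G u v .edges = edges G ∖ ｛ u — v ｝
deleteEdge G u v .loopless x = cong (_∧ _) (loopless G x)

updateGraph : (G : Graph n) → Update G → Graph n
updateGraph G (insert u v u≢v _) = insertEdge G u v u≢v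
updateGraph G (delete u v _)     = deleteEdge G u v

module Algorithm (procedures : Procedures n) where
  open Procedures procedures

  augmentingPathSearch : Graph n → EdgeSet n → Fin n → EdgeSet n
  augmentingPathSearch G M x with findAugmentingPath G M x
  ... | just p  = M △ pathEdges p
  ... | nothing = M

  searchIfFree : Graph n → EdgeSet n → Fin n → EdgeSet n
  searchIfFree G M x with free? M x
  ... | yes _ = augmentingPathSearch G M x
  ... | no  _ = M

  -- G is the graph after the insertion of {u,v}.
  handleInsertion : Graph n → EdgeSet n → Fin n → Fin n → EdgeSet n
  handleInsertion G M u v with free? M u | free? M v
  ... | yes _ | yes _ = M ∪ ｛ u — v ｝
  ... | yes _ | no  _ = augmentingPathSearch G M u
  ... | no  _ | yes _ = augmentingPathSearch G M v
  ... | no  _ | no  _ with findReachableFree G M u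
  ...   | just x  = augmentingPathSearch G M x
  ...   | nothing = M

  -- G is the graph after the deletion of {u,v}.
  handleDeletion : Graph n → EdgeSet n → Fin n → Fin n → EdgeSet n
  handleDeletion G M u v = searchIfFree G (searchIfFree G (M ∖ ｛ u — v ｝) u) v

  updateMatching : (G : Graph n) → EdgeSet n → Update G → EdgeSet n
  updateMatching G M U@(insert u v _ _) = handleInsertion (updateGraph G U) M u v
  updateMatching G M U@(delete u v _)   = handleDeletion (updateGraph G U) M u v

{-# OPTIONS --safe #-}
-- By Berge's theorem a matching is maximum as soon as it has no augmenting path.  After
-- an insertion every augmenting path contains the new edge uv, after the deletion of a
-- matched edge every augmenting path contains u or v, and in both cases one augmentation
-- reaches the maximum.  It remains to see that the algorithm searches from a vertex that
-- starts an augmenting path whenever there is any.  A free vertex on an augmenting path is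
-- one of its ends.  If u and v are both matched, then a free vertex z with an alternating
-- path to a vertex of an augmenting path P starts an augmenting path itself: follow that
-- path from z until it first meets P, then go along P in the direction of the matched edge.
module Submission where

open import Data.Bool.Base using (Bool; true; false; not; _∧_; _∨_; if_then_else_)
open import Data.Bool.Properties
  using (¬-not; not-involutive; ∧-conicalˡ; ∧-conicalʳ; ∧-identityʳ; ∧-zeroʳ;
         ∨-identityʳ; ∨-zeroʳ; xor-identityʳ)
import Data.Bool.Properties as Bool
open import Data.Fin.Base using (Fin; zero; suc) renaming (_≤_ to _≤ᶠ_)
open import Data.Fin.Properties using (_≟_; _≤?_; any?; ≤-antisym; ≤-total)
open import Data.List.Base using (List; []; _∷_; last)
open import Data.List.Membership.Propositional using (_∈_; _∉_)
open import Data.List.Membership.Propositional.Properties using (∈-++⁺ˡ; ∈-++⁺ʳ)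
import Data.List.Membership.DecPropositional as DecMembership
open import Data.List.Relation.Binary.Subset.Propositional using (_⊆_)
open import Data.List.Relation.Unary.All using ([]; _∷_)
open import Data.List.Relation.Unary.All.Properties using (All¬⇒¬Any; ¬Any⇒All¬)
open import Data.List.Relation.Unary.AllPairs using ([]; _∷_)
open import Data.List.Relation.Unary.Any using (Any; here; there)
import Data.List.Relation.Unary.Any as Any
open import Data.List.Relation.Unary.Linked using (Linked; [-]; _∷_)
open import Data.List.Relation.Unary.Unique.Propositional using (Unique)
open import Data.Maybe.Base using (just; nothing)
open import Data.Nat.Base using (ℕ; zero; suc; _+_; _≤_; _<_; s≤s; ⌊_/2⌋)
open import Data.Nat.Properties as ℕ using (+-0-commutativeMonoid)
open import Data.Product.Base using (∃; ∃₂; _×_; _,_; proj₁; proj₂)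
open import Data.Sum.Base using (_⊎_; inj₁; inj₂; [_,_]′)
open import Function.Base using (_∘_; id)
open import Relation.Binary.PropositionalEquality
open import Relation.Nullary using (¬_; Dec; yes; no; does; contradiction)
open import Defs

open import Algebra.Properties.CommutativeMonoid.Sum +-0-commutativeMonoid
  using (sum-syntax; sum-cong-≗; sum-replicate-zero; ∑-distrib-+; ∑-comm)

module _ {n : ℕ} where
  open DecMembership (_≟_ {n}) public using (_∈?_)

private variable
  n : ℕ
  b : Bool
  u v w x y z : Fin n
  p q l : List (Fin n)
  G : Graph n
  E M N S T : EdgeSet n

-- Edge sets

infix 4 _≐_
-- Pointwise, because edge sets are records of functions; sizes and matchings are transported along
-- it by `card-cong` and `matching-cong`.
_≐_ : EdgeSet n → EdgeSet n → Set
S ≐ T = ∀ x y → mem S x y ≡ mem T x y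

∨-true⁻ : ∀ a {b} → a ∨ b ≡ true → a ≡ true ⊎ b ≡ true
∨-true⁻ true  _ = inj₁ refl
∨-true⁻ false h = inj₂ h

symmetric : (S : EdgeSet n) → mem S x y ≡ b → mem S y x ≡ b
symmetric S h = trans (mem-symmetric S _ _) h

pair⁻ : (u v x y : Fin n) → x — y ∈ ｛ u — v ｝ → (x ≡ u × y ≡ v) ⊎ (x ≡ v × y ≡ u)
pair⁻ u v x y h with x ≟ u | y ≟ v | x ≟ v | y ≟ u
... | yes a | yes b | _     | _     = inj₁ (a , b)
... | yes _ | no  _ | yes c | yes d = inj₂ (c , d)
... | no  _ | _     | yes c | yes d = inj₂ (c , d)

pair-refl : (u v : Fin n) → u — v ∈ ｛ u — v ｝
pair-refl u v with u ≟ u | v ≟ v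
... | yes _ | yes _ = refl
... | yes _ | no v≢ = contradiction refl v≢
... | no u≢ | _     = contradiction refl u≢

avoids-pair : x ≢ u → x ≢ v → ∀ y → mem ｛ u — v ｝ x y ≡ false
avoids-pair x≢u x≢v y = ¬-not ([ x≢u ∘ proj₁ , x≢v ∘ proj₁ ]′ ∘ pair⁻ _ _ _ y)

pair-misses : (u v : Fin n) → u ≢ x → u ≢ y → mem ｛ u — v ｝ x y ≡ false
pair-misses u v u≢x u≢y =
  ¬-not ([ u≢x ∘ sym ∘ proj₁ , u≢y ∘ sym ∘ proj₂ ]′ ∘ pair⁻ u v _ _)

∪-off : (S T : EdgeSet n) → mem T x y ≡ false → mem (S ∪ T) x y ≡ mem S x y
∪-off {x = x} {y} S T h rewrite h = ∨-identityʳ (mem S x y)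

∖-off : (S T : EdgeSet n) → mem T x y ≡ false → mem (S ∖ T) x y ≡ mem S x y
∖-off {x = x} {y} S T h rewrite h = ∧-identityʳ (mem S x y)

∖-on : (S T : EdgeSet n) → x — y ∈ T → mem (S ∖ T) x y ≡ false
∖-on {x = x} {y} S T h rewrite h = ∧-zeroʳ (mem S x y)

∪-introˡ : (S T : EdgeSet n) → x — y ∈ S → x — y ∈ S ∪ T
∪-introˡ S T h rewrite h = refl

∪-introʳ : (S T : EdgeSet n) → x — y ∈ T → x — y ∈ S ∪ T
∪-introʳ {x = x} {y} S T h rewrite h = ∨-zeroʳ (mem S x y)

∖⊆ : (S T : EdgeSet n) → x — y ∈ S ∖ T → x — y ∈ S
∖⊆ S T = ∧-conicalˡ _ _

∖-∪-pair : (S : EdgeSet n) → u — v ∈ S → S ≐ (S ∖ ｛ u — v ｝) ∪ ｛ u — v ｝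
∖-∪-pair {u = u} {v} S uv x y with mem ｛ u — v ｝ x y in eq
... | false = sym (trans (∨-identityʳ _) (∧-identityʳ _))
... | true  = trans (on (pair⁻ u v x y eq)) (sym (∨-zeroʳ _))
  where
  on : (x ≡ u × y ≡ v) ⊎ (x ≡ v × y ≡ u) → x — y ∈ S
  on (inj₁ (refl , refl)) = uv
  on (inj₂ (refl , refl)) = symmetric S uv

∖-∉-pair : (S : EdgeSet n) → mem S u v ≡ false → S ∖ ｛ u — v ｝ ≐ S
∖-∉-pair {u = u} {v} S uv∉S x y with mem ｛ u — v ｝ x y in eq
... | false = ∧-identityʳ _
... | true  = trans (∧-zeroʳ _) (sym (off (pair⁻ u v x y eq)))
  where
  off : (x ≡ u × y ≡ v) ⊎ (x ≡ v × y ≡ u) → mem S x y ≡ false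
  off (inj₁ (refl , refl)) = uv∉S
  off (inj₂ (refl , refl)) = symmetric S uv∉S

-- Counting edges

Loopless : EdgeSet n → Set
Loopless S = ∀ x → mem S x x ≡ false

⟦_⟧ : Bool → ℕ
⟦ b ⟧ = if b then 1 else 0

degree : EdgeSet n → Fin n → ℕ
degree S i = ∑[ j < _ ] ⟦ mem S i j ⟧

card-cong : (S T : EdgeSet n) → S ≐ T → ∣ S ∣ ≡ ∣ T ∣
card-cong S T S≐T = sum-cong-≗ λ i → sum-cong-≗ λ j →
  cong (λ b → ⟦ does (i ≤? j) ∧ b ⟧) (S≐T i j)

-- The handshake lemma. Exchanging the summations in the second copy of `∣ S ∣` makes it count each
-- pair from its other end, so the two copies together fill the whole symmetric matrix.
∑-degree : (S : EdgeSet n) → Loopless S → ∑[ i < n ] degree S i ≡ ∣ S ∣ + ∣ S ∣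
∑-degree {n} S S-loopless = sym (begin
  ∣ S ∣ + ∣ S ∣
    ≡⟨ cong (∣ S ∣ +_) (∑-comm upper) ⟩
  ∣ S ∣ + ∑[ i < n ] ∑[ j < n ] upper j i
    ≡⟨ ∑-distrib-+ (λ i → ∑[ j < n ] upper i j) _ ⟨
  ∑[ i < n ] (∑[ j < n ] upper i j + ∑[ j < n ] upper j i)
    ≡⟨ sum-cong-≗ (λ i → ∑-distrib-+ (upper i) _) ⟨
  ∑[ i < n ] ∑[ j < n ] (upper i j + upper j i)
    ≡⟨ sum-cong-≗ (λ i → sum-cong-≗ (both i)) ⟩
  ∑[ i < n ] degree S i ∎)
  where
  open ≡-Reasoning
  upper : Fin n → Fin n → ℕ
  upper i j = ⟦ does (i ≤? j) ∧ mem S i j ⟧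

  both : ∀ i j → upper i j + upper j i ≡ ⟦ mem S i j ⟧
  both i j = by-cases (i ≤? j) (j ≤? i)
    where
    by-cases : (d : Dec (i ≤ᶠ j)) (e : Dec (j ≤ᶠ i)) →
               ⟦ does d ∧ mem S i j ⟧ + ⟦ does e ∧ mem S j i ⟧ ≡ ⟦ mem S i j ⟧
    by-cases (yes _)   (no  _)   = ℕ.+-identityʳ _
    by-cases (no  _)   (yes _)   = cong ⟦_⟧ (mem-symmetric S j i)
    by-cases (no  i≰j) (no  j≰i) = contradiction (≤-total i j) [ i≰j , j≰i ]′
    -- A diagonal entry would be counted twice, but it is zero since there are no loops.
    by-cases (yes i≤j) (yes j≤i) with refl ← ≤-antisym i≤j j≤i
      rewrite S-loopless i = refl

∑-indicator : (u : Fin n) → ∑[ i < n ] ⟦ does (i ≟ u) ⟧ ≡ 1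
∑-indicator {suc n} zero = cong suc (sum-replicate-zero n)
∑-indicator (suc u)      = ∑-indicator u

∑-indicator-pair : (u v : Fin n) →
  ∑[ i < n ] ∑[ j < n ] ⟦ does (i ≟ u) ∧ does (j ≟ v) ⟧ ≡ 1
∑-indicator-pair {n} u v = trans (sum-cong-≗ λ i → row (does (i ≟ u))) (∑-indicator u)
  where
  row : ∀ b → ∑[ j < n ] ⟦ b ∧ does (j ≟ v) ⟧ ≡ ⟦ b ⟧
  row true  = ∑-indicator v
  row false = sum-replicate-zero n

-- The sizes are doubled because the degree sum does not depend on which of `u` and `v` comes first:
-- the new edge adds exactly the entries `uv` and `vu`.
card-∪-pair : (S : EdgeSet n) → Loopless S → u ≢ v → mem S u v ≡ false → ∣ S ∪ ｛ u — v ｝ ∣ ≡ suc ∣ S ∣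
card-∪-pair {n} {u} {v} S S-loopless u≢v uv∉S = halve (begin
  ∣ S⁺ ∣ + ∣ S⁺ ∣
    ≡⟨ ∑-degree S⁺ S⁺-loopless ⟨
  ∑[ i < n ] degree S⁺ i
    ≡⟨ sum-cong-≗ (λ i → trans (sum-cong-≗ (split i))
         (trans (∑-distrib-+ (λ j → ⟦ mem S i j ⟧) _)
                (cong (degree S i +_) (∑-distrib-+ (δ u v i) _)))) ⟩
  ∑[ i < n ] (degree S i + (∑[ j < n ] δ u v i j + ∑[ j < n ] δ v u i j))
    ≡⟨ trans (∑-distrib-+ (degree S) _) (cong (_ +_) (∑-distrib-+ (λ i → ∑[ j < n ] δ u v i j) _)) ⟩
  ∑[ i < n ] degree S i + (∑[ i < n ] ∑[ j < n ] δ u v i j + ∑[ i < n ] ∑[ j < n ] δ v u i j)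
    ≡⟨ cong₂ _+_ (∑-degree S S-loopless) (cong₂ _+_ (∑-indicator-pair u v) (∑-indicator-pair v u)) ⟩
  ∣ S ∣ + ∣ S ∣ + 2
    ≡⟨ trans (ℕ.+-comm _ 2) (cong suc (sym (ℕ.+-suc _ _))) ⟩
  suc ∣ S ∣ + suc ∣ S ∣ ∎)
  where
  open ≡-Reasoning
  S⁺ = S ∪ ｛ u — v ｝

  δ : Fin n → Fin n → Fin n → Fin n → ℕ
  δ a b i j = ⟦ does (i ≟ a) ∧ does (j ≟ b) ⟧

  S⁺-loopless : Loopless S⁺
  S⁺-loopless x = trans (∪-off S ｛ u — v ｝ (¬-not (loop ∘ pair⁻ u v x x))) (S-loopless x)
    where
    loop : ¬ ((x ≡ u × x ≡ v) ⊎ (x ≡ v × x ≡ u))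
    loop (inj₁ (refl , refl)) = u≢v refl
    loop (inj₂ (refl , refl)) = u≢v refl

  split : ∀ i j → ⟦ mem S⁺ i j ⟧ ≡ ⟦ mem S i j ⟧ + (δ u v i j + δ v u i j)
  -- No entry is counted by two of the three summands: `u ≢ v` separates the two indicators, and
  -- `uv∉S` separates them from `S`.
  split i j with i ≟ u | j ≟ v | i ≟ v | j ≟ u
  ... | yes refl | _        | yes refl | _ = contradiction refl u≢v
  ... | yes refl | yes refl | no _  | _     rewrite uv∉S = refl
  ... | yes refl | no _     | no _  | _     rewrite ∨-identityʳ (mem S i j) = sym (ℕ.+-identityʳ _)
  ... | no _     | _        | yes refl | yes refl rewrite symmetric S uv∉S = refl
  ... | no _     | _        | yes refl | no _ rewrite ∨-identityʳ (mem S i j) = sym (ℕ.+-identityʳ _)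
  ... | no _     | _        | no _  | _     rewrite ∨-identityʳ (mem S i j) = sym (ℕ.+-identityʳ _)

  halve : ∀ {a b} → a + a ≡ b + b → a ≡ b
  halve {a} {b} eq = trans (ℕ.n≡⌊n+n/2⌋ a) (trans (cong ⌊_/2⌋ eq) (sym (ℕ.n≡⌊n+n/2⌋ b)))

card-∖-pair : (S : EdgeSet n) → Loopless S → u ≢ v → u — v ∈ S →
              suc ∣ S ∖ ｛ u — v ｝ ∣ ≡ ∣ S ∣
card-∖-pair {u = u} {v} S S-loopless u≢v uv = sym
  (trans (card-cong S (S⁻ ∪ ｛ u — v ｝) (∖-∪-pair S uv))
         (card-∪-pair S⁻ (λ x → cong (_∧ _) (S-loopless x)) u≢v
           (∖-on S ｛ u — v ｝ (pair-refl u v))))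
  where
  S⁻ = S ∖ ｛ u — v ｝

sum-<⁻ : (f g : Fin n → ℕ) → ∑[ i < n ] f i < ∑[ i < n ] g i → ∃ λ i → f i < g i
sum-<⁻ {suc n} f g h with f zero ℕ.<? g zero
... | yes f<g = zero , f<g
... | no  f≮g with i , f<g ← sum-<⁻ (f ∘ suc) (g ∘ suc)
                   (ℕ.+-cancelˡ-< (f zero) _ _ (ℕ.<-≤-trans h (ℕ.+-monoˡ-≤ _ (ℕ.≮⇒≥ f≮g)))) = suc i , f<g

-- Matchings

open IsMatching
open IsMaximumMatching

matching-loopless : IsMatching G M → Loopless M
matching-loopless {G = G} mM x =
  ¬-not λ xx → contradiction (trans (sym (subset mM xx)) (loopless G x)) λ ()

matching-irreflexive : IsMatching G M → x — y ∈ M → x ≢ y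
matching-irreflexive {x = x} mM xy refl = contradiction (trans (sym xy) (matching-loopless mM x)) λ ()

free⇒∉ : Free M x → mem M x y ≡ false
free⇒∉ x-free = ¬-not λ xy → x-free (_ , xy)

matching-cong : S ≐ T → IsMatching G T → IsMatching G S
matching-cong S≐T mT .subset xy = subset mT (trans (sym (S≐T _ _)) xy)
matching-cong S≐T mT .disjoint xy xz =
  disjoint mT (trans (sym (S≐T _ _)) xy) (trans (sym (S≐T _ _)) xz)

matching-∖ : (M T : EdgeSet n) → IsMatching G M → IsMatching G (M ∖ T)
matching-∖ M T mM .subset xy = subset mM (∖⊆ M T xy)
matching-∖ M T mM .disjoint xy xz = disjoint mM (∖⊆ M T xy) (∖⊆ M T xz)

matching-∪ : IsMatching G M → Free M u → Free M v → u — v ∈ edges G →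
             IsMatching G (M ∪ ｛ u — v ｝)
matching-∪ {G = G} {M} {u} {v} mM u-free v-free uv .subset {x} {y} h with ∨-true⁻ (mem M x y) h
... | inj₁ xy = subset mM xy
... | inj₂ xy with pair⁻ u v x y xy
...   | inj₁ (refl , refl) = uv
...   | inj₂ (refl , refl) = symmetric (edges G) uv
matching-∪ {G = G} {M} {u} {v} mM u-free v-free uv .disjoint {x} {y} {z} h k
  with ∨-true⁻ (mem M x y) h | ∨-true⁻ (mem M x z) k
... | inj₁ xy | inj₁ xz = disjoint mM xy xz
... | inj₁ xy | inj₂ xz with pair⁻ u v x z xz
...   | inj₁ (refl , refl) = contradiction (_ , xy) u-free
...   | inj₂ (refl , refl) = contradiction (_ , xy) v-free
matching-∪ {G = G} {M} {u} {v} mM u-free v-free uv .disjoint {x} {y} {z} h k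
    | inj₂ xy | inj₁ xz with pair⁻ u v x y xy
...   | inj₁ (refl , refl) = contradiction (_ , xz) u-free
...   | inj₂ (refl , refl) = contradiction (_ , xz) v-free
matching-∪ {G = G} {M} {u} {v} mM u-free v-free uv .disjoint {x} {y} {z} h k
    | inj₂ xy | inj₂ xz with pair⁻ u v x y xy | pair⁻ u v x z xz
...   | inj₁ (_ , refl)    | inj₁ (_ , refl)    = refl
...   | inj₂ (_ , refl)    | inj₂ (_ , refl)    = refl
...   | inj₁ (refl , refl) | inj₂ (refl , refl) = refl
...   | inj₂ (refl , refl) | inj₁ (refl , refl) = refl

card-matching-∪ : IsMatching G M → Free M u → u ≢ v → ∣ M ∪ ｛ u — v ｝ ∣ ≡ suc ∣ M ∣
card-matching-∪ {M = M} mM u-free u≢v =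
  card-∪-pair M (matching-loopless mM) u≢v (free⇒∉ {M = M} u-free)

card-matching-∖ : IsMatching G M → u — v ∈ M → suc ∣ M ∖ ｛ u — v ｝ ∣ ≡ ∣ M ∣
card-matching-∖ {M = M} mM uv =
  card-∖-pair M (matching-loopless mM) (matching-irreflexive mM uv) uv

∖-freesˡ : IsMatching G M → u — v ∈ M → Free (M ∖ ｛ u — v ｝) u
∖-freesˡ {M = M} {u} {v} mM uv (w , uw) with refl ← disjoint mM uv (∖⊆ M ｛ u — v ｝ uw) =
  contradiction (trans (sym uw) (∖-on M ｛ u — v ｝ (pair-refl u v))) λ ()

∖-freesʳ : IsMatching G M → u — v ∈ M → Free (M ∖ ｛ u — v ｝) v
∖-freesʳ {M = M} {u} {v} mM uv (w , vw)
  with refl ← disjoint mM (symmetric M uv) (∖⊆ M ｛ u — v ｝ vw) =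
  contradiction (trans (sym vw) (∖-on M ｛ u — v ｝ (trans (mem-symmetric ｛ u — v ｝ v u) (pair-refl u v)))) λ ()

∖-free : (M T : EdgeSet n) → Free M x → Free (M ∖ T) x
∖-free M T x-free (y , xy) = x-free (y , ∖⊆ M T xy)

∖-free⁻ : (M : EdgeSet n) → x ≢ u → x ≢ v → Free (M ∖ ｛ u — v ｝) x → Free M x
∖-free⁻ {u = u} {v} M x≢u x≢v x-free (y , xy) =
  x-free (y , trans (∖-off M ｛ u — v ｝ (avoids-pair x≢u x≢v y)) xy)

∪-free : (M : EdgeSet n) → x ≢ u → x ≢ v → Free M x → Free (M ∪ ｛ u — v ｝) x
∪-free {u = u} {v} M x≢u x≢v x-free (y , xy) =
  x-free (y , trans (sym (∪-off M ｛ u — v ｝ (avoids-pair x≢u x≢v y))) xy)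

-- The row of `x` is the indicator of its mate `y`.
degree-matched : IsMatching G M → x — y ∈ M → degree M x ≡ 1
degree-matched {M = M} {x} {y} mM xy = trans (sum-cong-≗ only-y) (∑-indicator y)
  where
  only-y : ∀ j → ⟦ mem M x j ⟧ ≡ ⟦ does (j ≟ y) ⟧
  only-y j with j ≟ y
  ... | yes refl rewrite xy = refl
  ... | no  j≢y = cong ⟦_⟧ (¬-not λ xj → j≢y (disjoint mM xj xy))

-- The degree sums are twice the sizes, so some `x` has smaller degree in `M` than in `N`, and some
-- entry `xy` lies in `N`. If `M` matched `x` as well, both degrees would be 1.
larger⇒covers-free : (M N : EdgeSet n) → IsMatching G M → IsMatching G N → ∣ M ∣ < ∣ N ∣ →
                     ∃₂ λ x y → Free M x × x — y ∈ N
larger⇒covers-free {n} M N mM mN M<N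
  with x , deg< ← sum-<⁻ (degree M) (degree N)
         (subst₂ _<_ (sym (∑-degree M (matching-loopless mM)))
                     (sym (∑-degree N (matching-loopless mN))) (ℕ.+-mono-< M<N M<N))
  with y , bit< ← sum-<⁻ (⟦_⟧ ∘ mem M x) (⟦_⟧ ∘ mem N x) deg<
  = x , y , free , xy
  where
  xy : x — y ∈ N
  xy = ¬-not λ xy∉N → contradiction (subst (λ b → ⟦ mem M x y ⟧ < ⟦ b ⟧) xy∉N bit<) λ ()

  free : Free M x
  free (z , xz) = ℕ.<-irrefl (trans (degree-matched mM xz) (sym (degree-matched mN xy))) deg<

-- Alternating paths

-- The Boolean tells whether the first edge lies in M; a single vertex is a path
-- for either value.
data Path {n} (E M : EdgeSet n) : Bool → Fin n → Fin n → List (Fin n) → Set where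
  stop : Path E M b x x (x ∷ [])
  step : mem M x y ≡ b → x — y ∈ E → x ∉ p → Path E M (not b) y z p →
         Path E M b x z (x ∷ p)

start∈ : Path E M b x y p → x ∈ p
start∈ stop           = here refl
start∈ (step _ _ _ _) = here refl

end∈ : Path E M b x y p → y ∈ p
end∈ stop           = here refl
end∈ (step _ _ _ P) = there (end∈ P)

-- Both conditions range over vertices of the path only, so a path survives every change at edges
-- that have an end off it.
mapPath : (∀ {v w} → v ∈ p → w ∈ p → v — w ∈ E → v — w ∈ S) →
          (∀ {v w} → v ∈ p → w ∈ p → mem M v w ≡ mem T v w) →
          Path E M b x y p → Path S T b x y p
mapPath E⇒S M≐T stop = stop
mapPath E⇒S M≐T (step m e x∉ P) =
  step (trans (sym (M≐T (here refl) (there (start∈ P)))) m)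
       (E⇒S (here refl) (there (start∈ P)) e) x∉
       (mapPath (λ v∈ w∈ → E⇒S (there v∈) (there w∈)) (λ v∈ w∈ → M≐T (there v∈) (there w∈)) P)

free-start : Free M x → x ≢ y → Path E M b x y p → Path E M false x y p
free-start x-free x≢y stop = contradiction refl x≢y
free-start {b = true}  x-free x≢y (step m e x∉ P) = contradiction (_ , m) x-free
free-start {b = false} x-free x≢y P = P

-- Only containment of the vertices is recorded, so that reversed segments and joined pieces qualify
-- too.
SubPath : (E M : EdgeSet n) → List (Fin n) → Bool → Fin n → Fin n → Set
SubPath E M l b x y = ∃ λ p → Path E M b x y p × p ⊆ l

-- Two paths that leave their only common vertex x by edges of different kinds form
-- one alternating path, which every vertex w of the first divides into two.
split : Path E M b x y p → Path E M (not b) x z q → (∀ {v} → v ∈ p → v ∈ q → v ≡ x) →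
        p ⊆ l → q ⊆ l → w ∈ p →
        ∃ λ c → SubPath E M l c w y × SubPath E M l (not c) w z
split {b = b} stop Q disj p⊆ q⊆ (here refl) = b , (_ , stop , p⊆) , (_ , Q , q⊆)
split {b = b} P@(step _ _ _ _) Q disj p⊆ q⊆ (here refl) = b , (_ , P , p⊆) , (_ , Q , q⊆)
-- The first edge is reversed and put in front of the second path, which moves the common vertex one
-- step towards `w`.
split {E = E} {M} {b} {x} {z = z} {q} {l} (step {y = y} {p = p} m e x∉p P) Q disj p⊆ q⊆ (there w∈) =
  split P Q⁺ disj⁺ (p⊆ ∘ there) q⁺⊆ w∈
  where
  y∉q : y ∉ q
  y∉q y∈q with refl ← disj (there (start∈ P)) y∈q = x∉p (start∈ P)

  Q⁺ : Path E M (not (not b)) y z (y ∷ q)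
  Q⁺ = subst (λ c → Path E M c y z (y ∷ q)) (sym (not-involutive b))
             (step (symmetric M m) (symmetric E e) y∉q Q)

  disj⁺ : v ∈ p → v ∈ y ∷ q → v ≡ y
  disj⁺ v∈p (here v≡y)  = v≡y
  disj⁺ v∈p (there v∈q) with refl ← disj (there v∈p) v∈q = contradiction v∈p x∉p

  q⁺⊆ : (y ∷ q) ⊆ l
  q⁺⊆ (here refl) = p⊆ (there (start∈ P))
  q⁺⊆ (there v∈q) = q⊆ v∈q

-- The second path is the single vertex `x`, so the second part is the initial segment up to `w`,
-- reversed.
split-at : Path E M b x y p → w ∈ p →
           ∃ λ c → SubPath E M p c w y × SubPath E M p (not c) w x
split-at P = split P stop (λ { _ (here v≡x) → v≡x }) id λ { (here refl) → start∈ P }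

-- The two directions from `w` carry opposite Booleans, so one of them is `true`. If `w` is an end
-- of the path, that one may be a single vertex.
matched-subpath : Path E M b x y p → w ∈ p → SubPath E M p true w y ⊎ SubPath E M p true w x
matched-subpath P w∈ with split-at P w∈
... | true  , Q , _ = inj₁ Q
... | false , _ , Q = inj₂ Q

record Augmenting {n} (E M : EdgeSet n) (x y : Fin n) (p : List (Fin n)) : Set where
  field
    path       : Path E M false x y p
    distinct   : x ≢ y
    start-free : Free M x
    end-free   : Free M y

open Augmenting

AugmentableFrom : (E M : EdgeSet n) → Fin n → Set
AugmentableFrom E M x = ∃₂ λ y p → Augmenting E M x y p

Augmentable : (E M : EdgeSet n) → Set
Augmentable E M = ∃ (AugmentableFrom E M)

-- The Boolean is arbitrary because no matched edge leaves a free vertex. Parts produced by `split`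
-- can thus be used without knowing their kind.
augmenting : Path E M b x y p → x ≢ y → Free M x → Free M y → Augmenting E M x y p
augmenting P x≢y x-free y-free = record
  { path = free-start x-free x≢y P ; distinct = x≢y ; start-free = x-free ; end-free = y-free }

-- The part from `w` to `y` joins distinct free vertices unless `w` is `y`; in that case the
-- reversed path from `y` to `x` does.
augmenting-from-free : Augmenting E M x y p → w ∈ p → Free M w →
                       ∃₂ λ z q → Augmenting E M w z q × q ⊆ p
augmenting-from-free {y = y} {w = w} A w∈ w-free with split-at (path A) w∈ | w ≟ y
... | _ , (q , Q , q⊆) , _ | no w≢y   = _ , q , augmenting Q w≢y w-free (end-free A) , q⊆
... | _ , _ , (q , Q , q⊆) | yes refl =
  _ , q , augmenting Q (distinct A ∘ sym) w-free (start-free A) , q⊆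

-- As the ends are distinct, the two parts at `w` cannot both be single vertices. In `berge` this
-- keeps isolated vertices off augmenting paths.
augmenting-covered : Augmenting E M x y p → w ∈ p → ∃ λ v → w — v ∈ E
augmenting-covered {y = y} {w = w} A w∈ with split-at (path A) w∈ | w ≟ y
... | _ , (_ , step _ wv _ _ , _) , _ | _        = _ , wv
... | _ , _ , (_ , step _ wv _ _ , _) | _        = _ , wv
... | _ , (_ , stop , _) , _          | no w≢y   = contradiction refl w≢y
... | _ , _ , (_ , stop , _)          | yes refl = contradiction refl (distinct A)

-- Take the last vertex of Q on p: from there Q continues with an unmatched edge,
-- as the mate of a vertex of p lies on p, so the reversed end of Q can be
-- continued along p starting with the matched edge.
augmenting-from-reachable : IsMatching G M → Augmenting E M x y p →
  Path E M b w z q → Free M z → Any (_∈ p) q → AugmentableFrom E M z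
augmenting-from-reachable mM A stop z-free (here z∈p)
  with _ , _ , B , _ ← augmenting-from-free A z∈p z-free = _ , _ , B
augmenting-from-reachable {G = G} {M} {E} {p = p} {b} {w} {z} mM A
    (step {y = v} {p = q} m e w∉q Q) z-free meets with Any.any? (_∈? p) q
... | yes meets′ = augmenting-from-reachable mM A Q z-free meets′
... | no  avoids =
    [ (λ R → join m Q R (end-free A)) , (λ R → join m Q R (start-free A)) ]′
      (matched-subpath (path A) (on-path meets))
  where
  off-path : ∀ {v} → v ∈ q → v ∉ p
  off-path v∈q v∈p = avoids (Any.map (λ { refl → v∈p }) v∈q)

  on-path : Any (_∈ p) (w ∷ q) → w ∈ p
  on-path (here w∈p)    = w∈p
  on-path (there meets) = contradiction meets avoids

  join : ∀ {y b} → mem M w v ≡ b → Path E M (not b) v z q →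
         SubPath E M p true w y → Free M y → AugmentableFrom E M z
  join {b = true} m Q (_ , stop , _) w-free = contradiction (_ , m) w-free
  join {b = true} m Q (_ , step wv′ _ _ R , r⊆) _ with refl ← disjoint mM m wv′ =
    contradiction (r⊆ (there (start∈ R))) (off-path (start∈ Q))
  join {y} {false} m Q (r , R , r⊆) y-free
    -- The two paths meet only in `w`. Splitting their union at its end `z` reads it as one path
    -- from `z` to `y`.
    with _ , _ , (s , S , _) ← split (step m e w∉q Q) R
           (λ { (here v≡w) _ → v≡w ; (there v∈q) v∈r → contradiction (r⊆ v∈r) (off-path v∈q) })
           ∈-++⁺ˡ (∈-++⁺ʳ (w ∷ q)) (there (end∈ Q)) =
    y , s , augmenting S z≢y z-free y-free
    where
    z≢y : z ≢ y
    z≢y refl = off-path (end∈ Q) (r⊆ (end∈ R))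

-- Augmentation and Berge's theorem

pathEdges-off : (p : List (Fin n)) → v ∉ p → mem (pathEdges p) v w ≡ false
pathEdges-off []          v∉ = refl
pathEdges-off (x ∷ [])    v∉ = refl
pathEdges-off {v = v} {w} (x ∷ y ∷ p) v∉ =
  trans (cong (_∨ mem (pathEdges (y ∷ p)) v w)
              (avoids-pair (v∉ ∘ here) (v∉ ∘ there ∘ here) w))
        (pathEdges-off (y ∷ p) (v∉ ∘ there))

-- The case split on the path exposes the first vertex of `p`, without which `pathEdges` does not
-- compute.
pathEdges-∷ : Path E M b x y p → pathEdges (w ∷ p) ≡ ｛ w — x ｝ ∪ pathEdges p
pathEdges-∷ stop           = refl
pathEdges-∷ (step _ _ _ _) = refl

∉⇒≢ : v ∉ p → w ∈ p → v ≢ w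
∉⇒≢ v∉ w∈ refl = v∉ w∈

-- Toggling the first two edges xy, yz of an augmenting path leaves a matching of the
-- same size for which the rest of the path is augmenting.
toggle-first-two : (M : EdgeSet n) (p : List (Fin n)) →
  mem M x y ≡ false → y — z ∈ M → x ∉ p → y ∉ p →
  M △ (｛ x — y ｝ ∪ (｛ y — z ｝ ∪ pathEdges p)) ≐
  ((M ∖ ｛ y — z ｝) ∪ ｛ x — y ｝) △ pathEdges p
toggle-first-two {x = x} {y} {z} M p xy yz x∉p y∉p a b
  with mem ｛ x — y ｝ a b in eq₁ | mem ｛ y — z ｝ a b in eq₂
... | false | false
  rewrite ∧-identityʳ (mem M a b) | ∨-identityʳ (mem M a b) = refl
... | true  | _ with pair⁻ x y a b eq₁
...   | inj₁ (refl , refl) rewrite xy | pathEdges-off {w = b} p x∉p = refl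
...   | inj₂ (refl , refl) rewrite symmetric M xy | pathEdges-off {w = b} p y∉p = refl
toggle-first-two {x = x} {y} {z} M p xy yz x∉p y∉p a b
    | false | true with pair⁻ y z a b eq₂
...   | inj₁ (refl , refl) rewrite yz | pathEdges-off {w = b} p y∉p = refl
...   | inj₂ (refl , refl)
  rewrite symmetric M yz | symmetric (pathEdges p) (pathEdges-off {w = a} p y∉p) = refl

-- The recursion removes two edges at a time. Exchanging `yz` for `xy` keeps the size; only the
-- final edge, which joins two free vertices, increases it.
augment : ∀ p → IsMatching G M → Augmenting (edges G) M x y p →
          IsMatching G (M △ pathEdges p) × ∣ M △ pathEdges p ∣ ≡ suc ∣ M ∣
augment _ mM record { path = stop ; distinct = x≢x } = contradiction refl x≢x
augment {M = M} {x} {y} _ mM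
        record { path = step xy∉M xy x∉ stop ; distinct = x≢y ; start-free = x-free ; end-free = y-free } =
  matching-cong same (matching-∪ mM x-free y-free xy) ,
  trans (card-cong (M △ pathEdges (x ∷ y ∷ [])) (M ∪ ｛ x — y ｝) same) (card-matching-∪ mM x-free x≢y)
  where
  same : M △ pathEdges (x ∷ y ∷ []) ≐ M ∪ ｛ x — y ｝
  same a b with mem ｛ x — y ｝ a b in eq
  ... | false = trans (xor-identityʳ _) (sym (∨-identityʳ _))
  ... | true with pair⁻ x y a b eq
  ...   | inj₁ (refl , refl) rewrite xy∉M = refl
  ...   | inj₂ (refl , refl) rewrite symmetric M xy∉M = refl
augment {n} {G} {M} {x} {t} _ mM
        record { path = step xy∉M xy x∉ (step {x = y} {y = z} {p = p} yz _ y∉p P)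
               ; start-free = x-free ; end-free = t-free } =
  matching-cong same (proj₁ rest) ,
  trans (card-cong (M △ pathEdges (x ∷ y ∷ p)) (M′ △ pathEdges p) same)
        (trans (proj₂ rest) (cong suc M′-size))
  where
  M⁻ = M ∖ ｛ y — z ｝
  M′ = M⁻ ∪ ｛ x — y ｝

  x≢y : x ≢ y
  x≢y = x∉ ∘ here

  x∉p : x ∉ p
  x∉p = x∉ ∘ there

  mM⁻ : IsMatching G M⁻
  mM⁻ = matching-∖ M ｛ y — z ｝ mM

  x-free⁻ : Free M⁻ x
  x-free⁻ = ∖-free M ｛ y — z ｝ x-free

  mM′ : IsMatching G M′
  mM′ = matching-∪ mM⁻ x-free⁻ (∖-freesˡ mM yz) xy

  M′-size : ∣ M′ ∣ ≡ ∣ M ∣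
  M′-size = trans (card-matching-∪ mM⁻ x-free⁻ x≢y) (card-matching-∖ mM yz)

  M≐M′ : ∀ {v w} → v ∈ p → w ∈ p → mem M v w ≡ mem M′ v w
  M≐M′ v∈ w∈ =
    trans (sym (∖-off M ｛ y — z ｝ (pair-misses y z (∉⇒≢ y∉p v∈) (∉⇒≢ y∉p w∈))))
          (sym (∪-off M⁻ ｛ x — y ｝ (pair-misses x y (∉⇒≢ x∉p v∈) (∉⇒≢ x∉p w∈))))

  free′ : ∀ {v} → v ∈ p → Free M⁻ v → Free M′ v
  free′ v∈ = ∪-free M⁻ (∉⇒≢ x∉p v∈ ∘ sym) (∉⇒≢ y∉p v∈ ∘ sym)

  z≢t : z ≢ t
  z≢t refl = t-free (y , symmetric M yz)

  rest : IsMatching G (M′ △ pathEdges p) × ∣ M′ △ pathEdges p ∣ ≡ suc ∣ M′ ∣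
  rest = augment p mM′ record
    { path       = mapPath (λ _ _ → id) M≐M′ P
    ; distinct   = z≢t
    ; start-free = free′ (start∈ P) (∖-freesʳ mM yz)
    ; end-free   = free′ (end∈ P) (∖-free M ｛ y — z ｝ t-free)
    }

  same : M △ pathEdges (x ∷ y ∷ p) ≐ M′ △ pathEdges p
  same a b rewrite pathEdges-∷ {w = y} P = toggle-first-two M p xy∉M yz x∉p y∉p a b

-- x is free in M and N contains xy.  If M contains yz, then M − yz and N − xy do not
-- touch x or y, so an augmenting path for M − yz either misses z or can be taken to
-- start there and be extended by x and y.
berge : ∀ k (M N : EdgeSet n) → ∣ M ∣ ≡ k → IsMatching G M → IsMatching G N → ∣ M ∣ < ∣ N ∣ →
        Augmentable (M ∪ N) M
berge {G = G} k M N M≡k mM mN M<N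
  with x , y , x-free , xy ← larger⇒covers-free M N mM mN M<N
  with any? (λ z → mem M y z Bool.≟ true)
... | no y-free = x , y , _ , augmenting
        (step (free⇒∉ {M = M} x-free) (∪-introʳ M N xy)
              (λ { (here x≡y) → matching-irreflexive mN xy x≡y }) stop)
        (matching-irreflexive mN xy) x-free y-free
-- The induction is on the size `k` of `M`; since `M` contains `yz`, it is a successor.
... | yes (z , yz) with k | trans (card-matching-∖ mM yz) M≡k
...   | suc k | sM′≡k = extend (berge k M′ N′ (ℕ.suc-injective sM′≡k) mM′ mN′ M′<N′)
  where
  M′ = M ∖ ｛ y — z ｝
  N′ = N ∖ ｛ x — y ｝

  mM′ : IsMatching G M′
  mM′ = matching-∖ M ｛ y — z ｝ mM

  mN′ : IsMatching G N′
  mN′ = matching-∖ N ｛ x — y ｝ mN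

  M′<N′ : ∣ M′ ∣ < ∣ N′ ∣
  M′<N′ = ℕ.≤-pred (subst₂ _<_ (sym (card-matching-∖ mM yz)) (sym (card-matching-∖ mN xy)) M<N)

  extend : Augmentable (M′ ∪ N′) M′ → Augmentable (M ∪ N) M
  extend (a , b , p , A) = by-cases (z ∈? p)
    where
    x∉p : x ∉ p
    x∉p x∈p with v , xv ← augmenting-covered A x∈p =
      [ (λ h → ∖-free M ｛ y — z ｝ x-free (v , h)) , (λ h → ∖-freesˡ mN xy (v , h)) ]′
        (∨-true⁻ (mem M′ x v) xv)

    y∉p : y ∉ p
    y∉p y∈p with v , yv ← augmenting-covered A y∈p =
      [ (λ h → ∖-freesˡ mM yz (v , h)) , (λ h → ∖-freesʳ mN xy (v , h)) ]′
        (∨-true⁻ (mem M′ y v) yv)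

    -- The path avoids `y`, hence the edge `yz`, the only one in which `M` and `M′` differ.
    lift : ∀ {c v w q} → q ⊆ p → Path (M′ ∪ N′) M′ c v w q → Path (M ∪ N) M c v w q
    lift q⊆p = mapPath
      (λ {v} {w} _ _ vw → [ ∪-introˡ M N ∘ ∖⊆ M ｛ y — z ｝ , ∪-introʳ M N ∘ ∖⊆ N ｛ x — y ｝ ]′
                            (∨-true⁻ (mem M′ v w) vw))
      (λ v∈ w∈ → ∖-off M ｛ y — z ｝
        (pair-misses y z (∉⇒≢ y∉p (q⊆p v∈)) (∉⇒≢ y∉p (q⊆p w∈))))

    free : ∀ {v} → v ∈ p → v ≢ z → Free M′ v → Free M v
    free v∈ = ∖-free⁻ M (∉⇒≢ y∉p v∈ ∘ sym)

    by-cases : Dec (z ∈ p) → Augmentable (M ∪ N) M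
    by-cases (no z∉p) = a , b , p , augmenting (lift id (path A)) (distinct A)
      (free (start∈ (path A)) (∉⇒≢ z∉p (start∈ (path A)) ∘ sym) (start-free A))
      (free (end∈ (path A)) (∉⇒≢ z∉p (end∈ (path A)) ∘ sym) (end-free A))
    by-cases (yes z∈p) with t , q , B , q⊆p ← augmenting-from-free A z∈p (∖-freesʳ mM yz) =
      x , t , x ∷ y ∷ q ,
      augmenting (step (free⇒∉ {M = M} x-free) (∪-introʳ M N xy) x∉yq
                   (step yz (∪-introˡ M N yz) (y∉p ∘ q⊆p) (lift q⊆p (path B))))
        (∉⇒≢ x∉p t∈p) x-free (free t∈p (distinct B ∘ sym) (end-free B))
      where
      t∈p : t ∈ p
      t∈p = q⊆p (end∈ (path B))

      x∉yq : x ∉ y ∷ q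
      x∉yq (here x≡y)  = matching-irreflexive mN xy x≡y
      x∉yq (there x∈q) = x∉p (q⊆p x∈q)

unaugmentable⇒maximum : IsMatching G M → ¬ Augmentable (edges G) M → IsMaximumMatching G M
unaugmentable⇒maximum mM ¬aug .isMatching = mM
unaugmentable⇒maximum {G = G} {M} mM ¬aug .maximum N mN = ℕ.≮⇒≥ λ M<N →
  let a , b , p , A = berge _ M N refl mM mN M<N
      E⇒G : ∀ {v w} → v — w ∈ M ∪ N → v — w ∈ edges G
      E⇒G {v} {w} = [ subset mM , subset mN ]′ ∘ ∨-true⁻ (mem M v w)
  in ¬aug (a , b , p , record { path       = mapPath (λ _ _ → E⇒G) (λ _ _ → refl) (path A)
                              ; distinct   = distinct A
                              ; start-free = start-free A
                              ; end-free   = end-free A })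

maximum⇒unaugmentable : IsMaximumMatching G M → ¬ Augmentable (edges G) M
maximum⇒unaugmentable maxM (_ , _ , p , A) with mM′ , M′≡ ← augment p (isMatching maxM) A =
  ℕ.1+n≰n (subst (_≤ _) M′≡ (maximum maxM _ mM′))

-- The searches

open AlternatingPath
open AugmentingPath

fromLinked : Linked (_—_∈ E) (x ∷ y ∷ p) → Unique (x ∷ y ∷ p) → Alternates M (x ∷ y ∷ p) →
             last (x ∷ y ∷ p) ≡ just z → Path E M (mem M x y) x z (x ∷ y ∷ p)
fromLinked (xy ∷ _) (x∉ ∷ _) ([_,_] _ _) refl = step refl xy (All¬⇒¬Any x∉) stop
fromLinked {E = E} {y = y} {M = M} {z = t} (xy ∷ es) (x∉ ∷ u) (_∷_ {z = z} {p = p} eq as) ends =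
  step refl xy (All¬⇒¬Any x∉)
       (subst (λ b → Path E M b y t (y ∷ z ∷ p)) (trans (sym (not-involutive _)) (cong not (sym eq)))
              (fromLinked es u as ends))

fromAlternatingPath : AlternatingPath G M x y p → ∃ λ b → Path (edges G) M b x y p
fromAlternatingPath {p = []} P = contradiction (starts P) λ ()
-- A single vertex is a path for either Boolean; `false` is an arbitrary choice.
fromAlternatingPath {p = _ ∷ []} P with refl ← starts P | refl ← ends P = false , stop
fromAlternatingPath {p = _ ∷ _ ∷ _} P with refl ← starts P =
  _ , fromLinked (walk P) (cycle-free P) (alternates P) (ends P)

alternates-∷ : Path E S b x y p → mem M v w ≡ not (mem M w x) →
               Alternates M (w ∷ p) → Alternates M (v ∷ w ∷ p)
alternates-∷ stop           eq as = eq ∷ as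
alternates-∷ (step _ _ _ _) eq as = eq ∷ as

alternatingPath-∷ : mem M w x ≡ b → w — x ∈ edges G → w ∉ p → Path (edges G) M (not b) x y p →
                    AlternatingPath G M x y p → AlternatingPath G M w y (w ∷ p)
alternatingPath-∷ _ e w∉ stop _ = record
  { starts = refl ; ends = refl ; walk = e ∷ [-]
  ; cycle-free = ¬Any⇒All¬ _ w∉ ∷ [] ∷ [] ; alternates = [_,_] _ _ }
alternatingPath-∷ {b = b} m e w∉ (step m′ _ _ P) tail = record
  { starts = refl ; ends = ends tail ; walk = e ∷ walk tail
  ; cycle-free = ¬Any⇒All¬ _ w∉ ∷ cycle-free tail
  ; alternates = alternates-∷ P (trans m (trans (sym (not-involutive b)) (cong not (sym m′))))
                                (alternates tail) }

toAlternatingPath : Path (edges G) M b x y p → AlternatingPath G M x y p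
toAlternatingPath stop = record
  { starts = refl ; ends = refl ; walk = [-] ; cycle-free = [] ∷ [] ; alternates = [_] _ }
toAlternatingPath (step m e x∉ P) = alternatingPath-∷ m e x∉ P (toAlternatingPath P)

fromAugmentingPath : AugmentingPath G M x y p → Augmenting (edges G) M x y p
fromAugmentingPath A = augmenting (proj₂ (fromAlternatingPath (alternatingPath A)))
  (distinct A) (start-free A) (end-free A)

toAugmentingPath : Augmenting (edges G) M x y p → AugmentingPath G M x y p
toAugmentingPath A = record
  { alternatingPath = toAlternatingPath (path A)
  ; distinct = distinct A ; start-free = start-free A ; end-free = end-free A }

-- A new edge

matching-insert : (u≢v : u ≢ v) → IsMatching G M → IsMatching (insertEdge G u v u≢v) M
matching-insert {u = u} {v} {G = G} u≢v mM .subset xy = ∪-introˡ (edges G) ｛ u — v ｝ (subset mM xy)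
matching-insert u≢v mM .disjoint = disjoint mM

matching-insert⁻ : (u≢v : u ≢ v) → IsMatching (insertEdge G u v u≢v) M → IsMatching G (M ∖ ｛ u — v ｝)
matching-insert⁻ {u = u} {v} {G} {M} u≢v mM .subset {x} {y} xy
  with ∨-true⁻ (mem (edges G) x y) (subset mM (∖⊆ M ｛ u — v ｝ xy))
... | inj₁ e = e
... | inj₂ e = contradiction (trans (sym xy) (∖-on M ｛ u — v ｝ e)) λ ()
matching-insert⁻ {u = u} {v} {M = M} u≢v mM .disjoint xy xz =
  disjoint mM (∖⊆ M ｛ u — v ｝ xy) (∖⊆ M ｛ u — v ｝ xz)

-- Removing the new edge costs a matching at most one edge and leaves a matching of the old graph.
-- Hence a single augmentation of `M` already reaches the maximum.
card-insert : (u≢v : u ≢ v) → IsMaximumMatching G M →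
              ∀ N → IsMatching (insertEdge G u v u≢v) N → ∣ N ∣ ≤ suc ∣ M ∣
card-insert {u = u} {v} {G} {M} u≢v maxM N mN with mem N u v in eq
... | true  = subst (_≤ _) (card-matching-∖ mN eq) (s≤s (maximum maxM _ (matching-insert⁻ u≢v mN)))
... | false = ℕ.m≤n⇒m≤1+n (subst (_≤ _) (card-cong (N ∖ ｛ u — v ｝) N (∖-∉-pair N eq))
                            (maximum maxM _ (matching-insert⁻ u≢v mN)))

-- A path that misses an end of the new edge uses old edges only, so it would contradict the
-- maximality of `M` in `G`.
augmenting-uses-inserted : (u≢v : u ≢ v) → IsMaximumMatching G M →
  Augmenting (edges (insertEdge G u v u≢v)) M x y p → u ∈ p × v ∈ p
augmenting-uses-inserted {n} {u} {v} {G} {M} {p = p} u≢v maxM A = uses here-u , uses here-v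
  where
  here-u : ∀ {a b} → a — b ∈ ｛ u — v ｝ → u ≡ a ⊎ u ≡ b
  here-u {a} {b} = [ inj₁ ∘ sym ∘ proj₁ , inj₂ ∘ sym ∘ proj₂ ]′ ∘ pair⁻ u v a b

  here-v : ∀ {a b} → a — b ∈ ｛ u — v ｝ → v ≡ a ⊎ v ≡ b
  here-v {a} {b} = [ inj₂ ∘ sym ∘ proj₂ , inj₁ ∘ sym ∘ proj₁ ]′ ∘ pair⁻ u v a b

  uses : ∀ {w} → (∀ {a b} → a — b ∈ ｛ u — v ｝ → w ≡ a ⊎ w ≡ b) → w ∈ p
  uses {w} incident with w ∈? p
  ... | yes w∈p = w∈p
  ... | no  w∉p = contradiction (_ , _ , p , old) (maximum⇒unaugmentable maxM)
    where
    old : Augmenting (edges G) M _ _ p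
    old = augmenting
      (mapPath (λ {a} {b} a∈ b∈ ab → [ id , (λ new → contradiction (incident {a} {b} new)
                  [ ∉⇒≢ w∉p a∈ , ∉⇒≢ w∉p b∈ ]′) ]′ (∨-true⁻ (mem (edges G) a b) ab))
               (λ _ _ → refl) (path A))
      (distinct A) (start-free A) (end-free A)

-- Correctness of the searches and of both updates

module _ (procedures : Procedures n) where
  open Procedures procedures
  open Algorithm procedures

  search-spec : IsMatching G M → Free M x →
    (IsMatching G (augmentingPathSearch G M x) × ∣ augmentingPathSearch G M x ∣ ≡ suc ∣ M ∣) ⊎
    (augmentingPathSearch G M x ≡ M × ¬ AugmentableFrom (edges G) M x)
  search-spec {G} {M} {x} mM x-free
    with findAugmentingPath G M x | findAugmentingPath-correct x mM x-free
  ... | just p  | _ , A = inj₁ (augment p mM (fromAugmentingPath A))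
  ... | nothing | none  = inj₂ (refl , λ (y , p , A) → none (y , p , toAugmentingPath A))

  -- A successful search attains the bound. After a failed one the last hypothesis rules out
  -- augmenting paths from every vertex, and Berge's theorem applies.
  search-maximum : IsMatching G M → Free M x → (∀ N → IsMatching G N → ∣ N ∣ ≤ suc ∣ M ∣) →
    (Augmentable (edges G) M → AugmentableFrom (edges G) M x) →
    IsMaximumMatching G (augmentingPathSearch G M x)
  search-maximum mM x-free bound from-x with search-spec mM x-free
  ... | inj₁ (mM′ , M′≡) = record
    { isMatching = mM′ ; maximum = λ N mN → subst (_ ≤_) (sym M′≡) (bound N mN) }
  ... | inj₂ (same , none) =
    subst (IsMaximumMatching _) (sym same) (unaugmentable⇒maximum mM (none ∘ from-x))

  -- This makes further searches harmless once the maximum is reached, as no augmenting path is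
  -- left.
  searchIfFree-maximum : IsMaximumMatching G M → IsMaximumMatching G (searchIfFree G M x)
  searchIfFree-maximum {G} {M} {x} maxM with free? M x
  ... | no _ = maxM
  ... | yes x-free = search-maximum (isMatching maxM) x-free
          (λ N mN → ℕ.m≤n⇒m≤1+n (maximum maxM N mN))
          (λ aug → contradiction aug (maximum⇒unaugmentable maxM))

  searchIfFree-free : Free M x → searchIfFree G M x ≡ augmentingPathSearch G M x
  searchIfFree-free {M = M} {x} x-free with free? M x
  ... | yes _         = refl
  ... | no  x-matched = contradiction x-free x-matched

  insertion-correct : (u≢v : u ≢ v) → IsMaximumMatching G M →
    IsMaximumMatching (insertEdge G u v u≢v) (handleInsertion (insertEdge G u v u≢v) M u v)
  insertion-correct {u} {v} {G} {M} u≢v maxM = by-cases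
    where
    G⁺ = insertEdge G u v u≢v

    mM : IsMatching G⁺ M
    mM = matching-insert {G = G} u≢v (isMatching maxM)

    bound : ∀ N → IsMatching G⁺ N → ∣ N ∣ ≤ suc ∣ M ∣
    bound = card-insert u≢v maxM

    from-free : ∀ {w} → (∀ {x y p} → Augmenting (edges G⁺) M x y p → w ∈ p) → Free M w →
                Augmentable (edges G⁺) M → AugmentableFrom (edges G⁺) M w
    from-free on-path w-free (_ , _ , _ , A)
      with z , q , B , _ ← augmenting-from-free A (on-path A) w-free = z , q , B

    u-on : Augmenting (edges G⁺) M x y p → u ∈ p
    u-on = proj₁ ∘ augmenting-uses-inserted u≢v maxM

    v-on : Augmenting (edges G⁺) M x y p → v ∈ p
    v-on = proj₂ ∘ augmenting-uses-inserted u≢v maxM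

    by-cases : IsMaximumMatching G⁺ (handleInsertion G⁺ M u v)
    by-cases with free? M u | free? M v
    ... | yes u-free | yes v-free = record
      { isMatching = matching-∪ mM u-free v-free (∪-introʳ (edges G) ｛ u — v ｝ (pair-refl u v))
      ; maximum    = λ N mN → subst (_ ≤_) (sym (card-matching-∪ mM u-free u≢v)) (bound N mN) }
    ... | yes u-free | no _       = search-maximum mM u-free bound (from-free u-on u-free)
    ... | no _       | yes v-free = search-maximum mM v-free bound (from-free v-on v-free)
    ... | no u-matched | no _
      with findReachableFree G⁺ M u | findReachableFree-correct {G⁺} u mM u-matched
    -- The path found starts at `u`, which lies on every augmenting path, so the two paths meet.
    ...   | just x | x-free , _ , P = search-maximum mM x-free bound λ (_ , _ , _ , A) →
              let Q = proj₂ (fromAlternatingPath P)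
              in augmenting-from-reachable mM A Q x-free
                   (Any.map (λ { refl → u-on A }) (start∈ Q))
    -- An augmenting path would pass through `u`, and its part from there to the free end `y` would
    -- make `y` reachable.
    ...   | nothing | unreachable = unaugmentable⇒maximum mM λ (_ , y , _ , A) →
              let _ , (q , Q , _) , _ = split-at (path A) (u-on A)
              in unreachable (y , end-free A , q , toAlternatingPath Q)

  -- Matchings of the smaller graph are matchings of `G`, so `∣ M ∣` stays an upper bound. Without
  -- `uv` the matching still attains it if `uv` was unmatched, and is one short otherwise.
  deletion-correct : u — v ∈ edges G → IsMaximumMatching G M →
    IsMaximumMatching (deleteEdge G u v) (handleDeletion (deleteEdge G u v) M u v)
  deletion-correct {u} {v} {G} {M} uv maxM = by-cases (mem M u v) refl
    where
    G⁻ = deleteEdge G u v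
    M⁻ = M ∖ ｛ u — v ｝

    mM : IsMatching G M
    mM = isMatching maxM

    mM⁻ : IsMatching G⁻ M⁻
    mM⁻ .subset xy = cong₂ _∧_ (subset mM (∖⊆ M ｛ u — v ｝ xy)) (∧-conicalʳ _ _ xy)
    mM⁻ .disjoint  = disjoint (matching-∖ M ｛ u — v ｝ mM)

    bound : ∀ N → IsMatching G⁻ N → ∣ N ∣ ≤ ∣ M ∣
    bound N mN = maximum maxM N record
      { subset = ∖⊆ (edges G) ｛ u — v ｝ ∘ subset mN ; disjoint = disjoint mN }

    unmatched-edge : mem M u v ≡ false → IsMaximumMatching G⁻ M⁻
    unmatched-edge uv∉M = record { isMatching = mM⁻ ; maximum = λ N mN →
      subst (_ ≤_) (sym (card-cong M⁻ M (∖-∉-pair M uv∉M))) (bound N mN) }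

    module _ (uv∈M : u — v ∈ M) where
      u-free : Free M⁻ u
      u-free = ∖-freesˡ mM uv∈M

      v-free : Free M⁻ v
      v-free = ∖-freesʳ mM uv∈M

      bound⁻ : ∀ N → IsMatching G⁻ N → ∣ N ∣ ≤ suc ∣ M⁻ ∣
      bound⁻ N mN = subst (_ ≤_) (sym (card-matching-∖ mM uv∈M)) (bound N mN)

      -- An augmenting path that avoids u and v is augmenting already for M in G.
      from-v : ¬ AugmentableFrom (edges G⁻) M⁻ u → Augmentable (edges G⁻) M⁻ →
               AugmentableFrom (edges G⁻) M⁻ v
      from-v none-u (a , b , p , A) with u ∈? p | v ∈? p
      ... | yes u∈p | _ with y , q , B , _ ← augmenting-from-free A u∈p u-free =
        contradiction (y , q , B) none-u
      ... | no _ | yes v∈p with y , q , B , _ ← augmenting-from-free A v∈p v-free = y , q , B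
      ... | no u∉p | no v∉p = contradiction (a , b , p , old) (maximum⇒unaugmentable maxM)
        where
        free : ∀ {w} → w ∈ p → Free M⁻ w → Free M w
        free w∈ = ∖-free⁻ M (∉⇒≢ u∉p w∈ ∘ sym) (∉⇒≢ v∉p w∈ ∘ sym)

        old : Augmenting (edges G) M a b p
        old = augmenting
          (mapPath (λ _ _ → ∖⊆ (edges G) ｛ u — v ｝)
                   (λ x∈ y∈ → ∖-off M ｛ u — v ｝ (pair-misses u v (∉⇒≢ u∉p x∈) (∉⇒≢ u∉p y∈)))
                   (path A))
          (distinct A) (free (start∈ (path A)) (start-free A)) (free (end∈ (path A)) (end-free A))

      matched-edge : IsMaximumMatching G⁻ (handleDeletion G⁻ M u v)
      matched-edge with search-spec mM⁻ u-free
      ... | inj₁ (mM′ , M′≡) = searchIfFree-maximum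
        (subst (IsMaximumMatching G⁻) (sym (searchIfFree-free u-free)) record
          { isMatching = mM′ ; maximum = λ N mN → subst (_ ≤_) (sym M′≡) (bound⁻ N mN) })
      -- The first search changed nothing, so `v` is still free and the second search does run.
      ... | inj₂ (same , none-u) =
        subst (IsMaximumMatching G⁻) (sym (trans
          (cong (λ S → searchIfFree G⁻ S v) (trans (searchIfFree-free u-free) same))
          (searchIfFree-free v-free)))
        (search-maximum mM⁻ v-free bound⁻ (from-v none-u))

    by-cases : ∀ b → mem M u v ≡ b → IsMaximumMatching G⁻ (handleDeletion G⁻ M u v)
    by-cases true  uv∈M = matched-edge uv∈M
    -- The ends of an unmatched edge may be free, so searches may still run; each preserves
    -- maximality.
    by-cases false uv∉M = searchIfFree-maximum (searchIfFree-maximum (unmatched-edge uv∉M))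

mainTheorem2 : ∀ (n : ℕ) (procedures : Procedures n)
    (G : Graph n) (M : EdgeSet n) (U : Update G) →
    IsMaximumMatching G M →
    IsMaximumMatching (updateGraph G U) (Algorithm.updateMatching procedures G M U)
mainTheorem2 n procedures G M (insert u v u≢v _) = insertion-correct procedures u≢v
mainTheorem2 n procedures G M (delete u v uv)    = deletion-correct procedures uv
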